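{- Let $\mathcal L$ be a stateful SOS specification over a signature $\Sigma$ and a countable set $S$ of states, let $\gamma_0\colon S\times\mu\Sigma\to S\times(\mu\Sigma+1)$ be its transition function, and let $\gamma\colon\mu\Sigma\to (S\times(\mu\Sigma+1))^S$ be its operational model, i.e. the operational model of the GSOS law $\hat\delta$ induced by the stateful SOS law $\delta$ associated to $\mathcal L$. Then $$\gamma=\mathrm{curry}(\gamma_0)\colon\mu\Sigma\to (S\times(\mu\Sigma+1))^S,$$ that is, $\gamma(p)(s)=\gamma_0(s,p)$ for all $p\in\mu\Sigma$ and $s\in S$.
   Context: **Signature and terms.** An algebraic signature $\Sigma$ is a set of operation symbols $\mathsf f$ with arities $\mathrm{ar}(\mathsf f)\in\mathbb N$; it is identified with the polynomial functor $\Sigma X=\coprod_{\mathsf f\in\Sigma}X^{\mathrm{ar}(\mathsf f)}$ on $\mathbf{Set}$. $\Sigma^{\star}X$ is the set of $\Sigma$-terms with variables from $X$ (free $\Sigma$-algebra; $\Sigma^\star$ is the free monad). $\mu\Sigma=\Sigma^\star\emptyset$ is the set of closed terms (programs), the initial $\Sigma$-algebra with structure $\iota\colon\Sigma(\mu\Sigma)\to\mu\Sigma$. For a $\Sigma$-algebra $(A,\alpha)$, $\hat\alpha\colon\Sigma^\star A\to A$ is the term evaluation map (the free extension of $\mathrm{id}_A$). $1=\{*\}$. $\mathcal V=\{x_1,x_2,\dots\}\cup\{y_1,y_2,\dots\}$ is a countably infinite set of variables. **Specifications.** A progressing literal is $s,p\to s',q$ and a terminating literal is $s,p\downarrow s'$,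 with $s,s'\in S$, $p,q\in\Sigma^\star\mathcal V$ (input $s$, source $p$, output $s'$, target $q$). A stateful SOS rule for an $n$-ary $\mathsf f$ is an expression $l_1\dots l_n/L$ of literals (premisses $l_j$, conclusion $L$) with the same input $s$, such that the source of $l_j$ is $x_j$, its target is $y_j$ if it is progressing, the source of $L$ is $\mathsf f(x_1,\dots,x_n)$, and if $L$ is progressing all variables of its target appear as source or target of some premiss. The rule is progressing/terminating if $L$ is. Its trigger is $(s,(s_1',\mathtt c_1),\dots,(s_n',\mathtt c_n))$, where $s_j'$ is the output of $l_j$ and $\mathtt c_j=\mathtt{pr}$ or $\mathtt{te}$ according to whether $l_j$ is progressing or terminating. A stateful SOS specification is a set of rules containing, for each $n$-ary $\mathsf f$ and each $(s,(s_1',\mathtt c_1),\dots,(s_n',\mathtt c_n))$ with $s,s_j'\in S$, $\mathtt c_j\in\{\mathtt{pr},\mathtt{te}\}$, exactly one rule for $\mathsf f$ with that trigger. **Associated law.** $\mathcal L$ induces a natural transformation $\delta_X\colon S\times\Sigma(X\times(S\times(X+1)))\to S\times(\Sigma^\star X+1)$, the copairing of maps $\delta^{\mathsf f}_X\colon S\times(X\times(S\times(X+1)))^{\mathrm{ar}(\mathsf f)}\to S\times(\Sigma^\star X+1)$: given $(s,((v_1,s_1',w_1),\dots,(v_n,s_n',w_n)))$, take the unique rule for $\mathsf f$ with trigger $(s,(s'_1,\mathtt c_1),\dots,(s'_n,\mathtt c_n))$, where $\mathtt c_j=\mathtt{pr}$ if $w_j\in X$ and $\mathtt c_j=\mathtt{te}$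 if $w_j=*$; with $s'$ the output of its conclusion, the value is $(s',*)$ if the rule is terminating and otherwise $(s',t')$, where $t'$ is the target of the conclusion with $x_j$ replaced by $v_j$ and $y_j$ by $w_j$. **Transition function.** $\gamma_0\colon S\times\mu\Sigma\to S\times(\mu\Sigma+1)$ is defined inductively by $\gamma_0(s,\mathsf f(t_1,\dots,t_n))=m(\delta^{\mathsf f}_{\mu\Sigma}(s,(d_1,\dots,d_n)))$, where $d_j=(t_j,\gamma_0(s,t_j))$ and $m=\mathrm{id}\times(\hat\iota+\mathrm{id})\colon S\times(\Sigma^\star(\mu\Sigma)+1)\to S\times(\mu\Sigma+1)$. **GSOS law and operational model.** Let $TX=(S\times(X+1))^S$. The GSOS law $\hat\delta_X\colon\Sigma(X\times TX)\to T\Sigma^\star X$ is given by $\hat\delta_X(\mathsf f((v_1,g_1),\dots,(v_n,g_n)))(s)=\delta^{\mathsf f}_X(s,((v_1,g_1(s)),\dots,(v_n,g_n(s))))$. Its operational model is the unique map $\gamma\colon\mu\Sigma\to T(\mu\Sigma)$ satisfying $\gamma\cdot\iota=T\hat\iota\cdot\hat\delta_{\mu\Sigma}\cdot\Sigma\langle\mathrm{id},\gamma\rangle$. -}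

module Defs where

open import Level using (0ℓ)
open import Data.Nat.Base using (ℕ)
open import Data.Fin.Base using (Fin; toℕ)
open import Data.Vec.Base as Vec using (Vec; []; _∷_; lookup; tabulate)
open import Data.Vec.Properties using (lookup-map)
open import Data.Vec.Relation.Unary.Any using (Any; here; there)
open import Data.Maybe.Base using (Maybe; just; nothing)
open import Data.Product.Base using (Σ-syntax; ∃; _×_; _,_; proj₁; proj₂; <_,_>; map₂; uncurry)
open import Data.Product using (∃!)
open import Data.Sum.Base as Sum using (_⊎_; inj₁; inj₂)
open import Data.Unit.Base using (⊤; tt)
open import Data.Empty using (⊥)
open import Function.Base using (_∘_; id)
open import Relation.Unary using (Pred; _∈_)
open import Relation.Binary.PropositionalEquality
  using (_≡_; refl; sym; trans; cong; module ≡-Reasoning)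

record Signature : Set₁ where
  field
    Op : Set
    ar : Op → ℕ

module Terms (Sig : Signature) where
  open Signature Sig

  -- The polynomial functor of the signature.  Arguments are vectors rather
  -- than functions out of Fin (ar f), so that terms with equal arguments are
  -- propositionally equal without function extensionality.
  ΣF : Set → Set
  ΣF X = Σ[ f ∈ Op ] Vec X (ar f)

  ΣF₁ : {X Y : Set} → (X → Y) → ΣF X → ΣF Y
  ΣF₁ h (f , xs) = f , Vec.map h xs

  data Σ⋆ (X : Set) : Set where
    var : X → Σ⋆ X
    op  : (f : Op) → Vec (Σ⋆ X) (ar f) → Σ⋆ X

  module _ {A : Set} (α : ΣF A → A) where
    eval  : Σ⋆ A → A
    evals : ∀ {n} → Vec (Σ⋆ A) n → Vec A n

    eval (var a)   = a
    eval (op f ts) = α (f , evals ts)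

    evals []       = []
    evals (t ∷ ts) = eval t ∷ evals ts

  μΣ : Set
  μΣ = Σ⋆ ⊥

  ι : ΣF μΣ → μΣ
  ι (f , ts) = op f ts

  ι̂ : Σ⋆ μΣ → μΣ
  ι̂ = eval ι

  data _∈vars_ {X : Set} (v : X) : Σ⋆ X → Set where
    here  : v ∈vars var v
    there : ∀ {f} {ts : Vec (Σ⋆ X) (ar f)} → Any (v ∈vars_) ts → v ∈vars op f ts

  -- Simultaneous substitution of elements of Y for variables, where the
  -- substitution need only be defined on the variables that occur in the term.
  module _ {X Y : Set} where
    replace  : (t : Σ⋆ X) → (∀ {v} → v ∈vars t → Y) → Σ⋆ Y
    replaces : ∀ {n} (ts : Vec (Σ⋆ X) n) → (∀ {v} → Any (v ∈vars_) ts → Y) → Vec (Σ⋆ Y) n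

    replace (var v)   σ = var (σ here)
    replace (op f ts) σ = op f (replaces ts (λ o → σ (there o)))

    replaces []       σ = []
    replaces (t ∷ ts) σ = replace t (λ o → σ (here o)) ∷ replaces ts (λ o → σ (there o))

-- Both families are numbered from 0, matching Fin, rather than from 1.
data 𝒱 : Set where
  x[_] y[_] : ℕ → 𝒱

data Kind : Set where
  pr te : Kind

module StatefulSOS (Sig : Signature) (S : Set) where
  open Signature Sig public
  open Terms Sig public

  data Literal : Set where
    ⟨_,_⟩⟶⟨_,_⟩ : (s : S) (p : Σ⋆ 𝒱) (s′ : S) (q : Σ⋆ 𝒱) → Literal
    ⟨_,_⟩↓_      : (s : S) (p : Σ⋆ 𝒱) (s′ : S) → Literal

  input : Literal → S
  input ⟨ s , p ⟩⟶⟨ s′ , q ⟩ = s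
  input (⟨ s , p ⟩↓ s′)       = s

  source : Literal → Σ⋆ 𝒱
  source ⟨ s , p ⟩⟶⟨ s′ , q ⟩ = p
  source (⟨ s , p ⟩↓ s′)       = p

  output : Literal → S
  output ⟨ s , p ⟩⟶⟨ s′ , q ⟩ = s′
  output (⟨ s , p ⟩↓ s′)       = s′

  target : Literal → Maybe (Σ⋆ 𝒱)
  target ⟨ s , p ⟩⟶⟨ s′ , q ⟩ = just q
  target (⟨ s , p ⟩↓ s′)       = nothing

  kind : Literal → Kind
  kind ⟨ s , p ⟩⟶⟨ s′ , q ⟩ = pr
  kind (⟨ s , p ⟩↓ s′)       = te

  -- The bare syntax of a rule; well-formedness is IsRule.  Keeping the two
  -- apart makes propositional equality of rules equality of expressions.
  record RuleExpr (n : ℕ) : Set where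
    constructor _/_
    field
      premisses  : Vec Literal n
      conclusion : Literal

  open RuleExpr public

  IsVarOfPremiss : ∀ {n} → Vec Literal n → 𝒱 → Set
  IsVarOfPremiss ls v =
    ∃ λ j → source (lookup ls j) ≡ var v ⊎ target (lookup ls j) ≡ just (var v)

  record IsRule (f : Op) (r : RuleExpr (ar f)) : Set where
    field
      same-input        : ∀ j → input (lookup (premisses r) j) ≡ input (conclusion r)
      premiss-source    : ∀ j → source (lookup (premisses r) j) ≡ var x[ toℕ j ]
      premiss-target    : ∀ j {q} → target (lookup (premisses r) j) ≡ just q →
                          q ≡ var y[ toℕ j ]
      conclusion-source : source (conclusion r) ≡ op f (tabulate (λ j → var x[ toℕ j ]))
      conclusion-vars   : ∀ {q} → target (conclusion r) ≡ just q →
                          ∀ {v} → v ∈vars q → IsVarOfPremiss (premisses r) v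

  Trigger : ℕ → Set
  Trigger n = S × Vec (S × Kind) n

  trigger : ∀ {n} → RuleExpr n → Trigger n
  trigger r = input (conclusion r) , Vec.map < output , kind > (premisses r)

  -- A set of rules is given as a family indexed by the operation symbol the
  -- rule is for; this symbol is determined by the source of the conclusion.
  record Specification : Set₁ where
    field
      Rules  : (f : Op) → Pred (RuleExpr (ar f)) 0ℓ
      isRule : ∀ {f r} → r ∈ Rules f → IsRule f r
      rule!  : ∀ f (τ : Trigger (ar f)) →
               ∃! _≡_ (λ r → r ∈ Rules f × trigger r ≡ τ)

  -- B X is S × (X + 1), and T X is (S × (X + 1))^S.
  B : Set → Set
  B X = S × (X ⊎ ⊤)

  B₁ : {X Y : Set} → (X → Y) → B X → B Y
  B₁ h = map₂ (Sum.map₁ h)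

  T : Set → Set
  T X = S → B X

  T₁ : {X Y : Set} → (X → Y) → T X → T Y
  T₁ h g = B₁ h ∘ g

  kindOf : {X : Set} → X ⊎ ⊤ → Kind
  kindOf (inj₁ _) = pr
  kindOf (inj₂ _) = te

  module _ {X : Set} where
    triggerOf : ∀ {n} → S × Vec (X × B X) n → Trigger n
    triggerOf (s , ds) = s , Vec.map (λ (v , s′ , w) → s′ , kindOf w) ds

    private
      fromProgressing : (w : X ⊎ ⊤) → pr ≡ kindOf w → X
      fromProgressing (inj₁ u) _ = u

      target⇒pr : ∀ l {q} → target l ≡ just q → pr ≡ kind l
      target⇒pr ⟨ _ , _ ⟩⟶⟨ _ , _ ⟩ _ = refl

      kind-agrees : ∀ {n} (r : RuleExpr n) (a : S × Vec (X × B X) n) →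
                    trigger r ≡ triggerOf a → ∀ j →
                    kind (lookup (premisses r) j) ≡ kindOf (proj₂ (proj₂ (lookup (proj₂ a) j)))
      kind-agrees r (s , ds) eq j = begin
        kind (lookup (premisses r) j)
          ≡⟨ cong proj₂ (lookup-map j _ (premisses r)) ⟨
        proj₂ (lookup (proj₂ (trigger r)) j)
          ≡⟨ cong (λ τ → proj₂ (lookup (proj₂ τ) j)) eq ⟩
        proj₂ (lookup (proj₂ (triggerOf (s , ds))) j)
          ≡⟨ cong proj₂ (lookup-map j _ ds) ⟩
        kindOf (proj₂ (proj₂ (lookup ds j)))
          ∎
        where open ≡-Reasoning

    -- The replacement x_j ↦ v_j, y_j ↦ w_j.  The source of the j-th premiss of
    -- a rule is x_j and its target, if any, is y_j; in the latter case the
    -- matching trigger forces w_j to lie in X.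
    assign : ∀ {n} (r : RuleExpr n) (a : S × Vec (X × B X) n) → trigger r ≡ triggerOf a →
             ∀ {v} → IsVarOfPremiss (premisses r) v → X
    assign r (s , ds) eq (j , inj₁ _) = proj₁ (lookup ds j)
    assign r (s , ds) eq (j , inj₂ p) =
      fromProgressing (proj₂ (proj₂ (lookup ds j)))
        (trans (target⇒pr (lookup (premisses r) j) p) (kind-agrees r (s , ds) eq j))

    -- The value contributed by a conclusion L, given how to replace the
    -- variables of its target.
    conclude : (L : Literal) → (∀ {q} → target L ≡ just q → ∀ {v} → v ∈vars q → X) → B (Σ⋆ X)
    conclude ⟨ s , p ⟩⟶⟨ s′ , q ⟩ σ = s′ , inj₁ (replace q (σ refl))
    conclude (⟨ s , p ⟩↓ s′)       σ = s′ , inj₂ tt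

  module Semantics (𝓛 : Specification) where
    open Specification 𝓛

    δᶠ : ∀ {X} (f : Op) → S × Vec (X × B X) (ar f) → B (Σ⋆ X)
    δᶠ f a with rule! f (triggerOf a)
    ... | r , (r∈ , eq) , _ =
      conclude (conclusion r) (λ tgt o → assign r a eq (IsRule.conclusion-vars (isRule r∈) tgt o))

    δ : ∀ {X} → S × ΣF (X × B X) → B (Σ⋆ X)
    δ (s , f , ds) = δᶠ f (s , ds)

    m : B (Σ⋆ μΣ) → B μΣ
    m = B₁ ι̂

    step  : S → μΣ → B μΣ
    steps : ∀ {n} → S → Vec μΣ n → Vec (μΣ × B μΣ) n

    step s (op f ts) = m (δᶠ f (s , steps s ts))

    steps s []       = []
    steps s (t ∷ ts) = (t , step s t) ∷ steps s ts

    γ₀ : S × μΣ → B μΣ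
    γ₀ = uncurry step

    δ̂ : ∀ {X} → ΣF (X × T X) → T (Σ⋆ X)
    δ̂ u s = δ (s , ΣF₁ (λ (v , g) → v , g s) u)

    -- γ · ι = T ι̂ · δ̂ · Σ⟨id , γ⟩, where equality of elements of T μΣ is
    -- pointwise because function extensionality is not available.
    IsOperationalModel : (μΣ → T μΣ) → Set
    IsOperationalModel γ = ∀ u s → γ (ι u) s ≡ T₁ ι̂ (δ̂ (ΣF₁ < id , γ > u)) s

    -- An operational model exists, so quantifying over all γ satisfying
    -- IsOperationalModel is not vacuous.
    private
      model  : μΣ → T μΣ
      models : ∀ {n} → Vec μΣ n → Vec (μΣ × T μΣ) n

      model (op f ts) = T₁ ι̂ (δ̂ (f , models ts))

      models []       = []
      models (t ∷ ts) = (t , model t) ∷ models ts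

      models-map : ∀ {n} (ts : Vec μΣ n) → models ts ≡ Vec.map < id , model > ts
      models-map []       = refl
      models-map (t ∷ ts) = cong ((t , model t) ∷_) (models-map ts)

    operationalModel-exists : ∃ IsOperationalModel
    operationalModel-exists =
      model , λ (f , ts) s → cong (λ us → T₁ ι̂ (δ̂ (f , us)) s) (models-map ts)

{-# OPTIONS --safe #-}
module Submission where

open import Defs
open import Data.Nat.Base using (ℕ)
open import Data.Product.Base using (_,_; <_,_>)
open import Data.Vec.Base as Vec using (Vec; []; _∷_)
open import Function.Base using (id)
open import Function.Bundles using (_↣_)
open import Relation.Binary.PropositionalEquality using (_≡_; refl; trans; cong; cong₂)

-- At a fixed state `s`, `δ̂` is just `δ` applied to the arguments' behaviours evaluated at `s`. So
-- the equation defining an operational model, read at `s`, is the recursion defining `γ₀`, and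
-- structural induction on programs identifies the two.

module _ (Sig : Signature) (S : Set) where
  open StatefulSOS Sig S

  module _ (𝓛 : Specification) where
    open Semantics 𝓛

    module _ (γ : μΣ → T μΣ) (γ-model : IsOperationalModel γ) where

      model≡step : ∀ p s → γ p s ≡ step s p

      -- The induction hypothesis for all arguments at once: the left side is what `δ̂` passes to
      -- `δ` at `s`. Mutual recursion with `model≡step` keeps the descent structural.
      map-model≡steps : ∀ {n} (ts : Vec μΣ n) s →
        Vec.map (λ (t , g) → t , g s) (Vec.map < id , γ > ts) ≡ steps s ts

      model≡step (op f ts) s =
        -- By unfolding `T₁` and `δ̂`, the right side of the model equation is already
        -- `m (δᶠ f (s , _))`.
        trans (γ-model (f , ts) s)
              (cong (λ ds → m (δᶠ f (s , ds))) (map-model≡steps ts s))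

      map-model≡steps []       s = refl
      map-model≡steps (t ∷ ts) s =
        cong₂ (λ b ds → (t , b) ∷ ds) (model≡step t s) (map-model≡steps ts s)

proposition4p4 : (Sig : Signature) (S : Set) → S ↣ ℕ →
    let open StatefulSOS Sig S in
    (𝓛 : Specification) →
    let open Semantics 𝓛 in
    (γ : μΣ → T μΣ) → IsOperationalModel γ →
    ∀ (p : μΣ) (s : S) → γ p s ≡ γ₀ (s , p)
proposition4p4 Sig S _ = model≡step Sig S
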